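{- Let $(G,c)$ be a payment network and $D$ a spanning representation of it. The image of the set of cycle-equivalence classes of configurations under the represented score map, i.e. $\{S_D(w): w \text{ a configuration}\}\subset\mathbb{R}^n$, is exactly the Minkowski sum of the vectors $\{c(x,y)D(x,y): (x,y)\in E,\ s(x,y)=1\}$ (one vector per edge, taken in its positive direction).
   Context: A payment network consists of a finite connected simple undirected graph $G=(V,E)$ and capacities $c:E\to\mathbb{R}_{\ge 0}$, $c(u,v)=c(v,u)$. Put $n=|V|-1$. A configuration is a map $w:V\times V\to\mathbb{R}_{\ge0}$ with $w(u,v)+w(v,u)=c(u,v)$ for every edge $(u,v)$ (and $w=0$ on non-adjacent pairs). A path is a walk $(v_0,\dots,v_t)$ in $G$ and is a cycle if $v_0=v_t$. Routing a payment of size $k$ along a path means: with $f_{(u,v)}$ equal to $k$ times the number of traversals of the ordered pair $(u,v)$, provided $f_{(u,v)}\le w(u,v)$ for all $(u,v)$, replace $w$ by $w'(u,v)=w(u,v)-f_{(u,v)}+f_{(v,u)}$. Two configurations are cycle-equivalent if one is reachable from the other by routing a series of payments along cycles; cycle-equivalent configurations have the same represented score, so $S_D$ is defined on classes. Fix an orientation $s:V\times V\to\{\pm1\}$ with $s(u,v)=-s(v,u)$ on edges. For $D:E\to\mathbb{R}^n$ the direction of a path is $D(p)=\sum_{i=0}^{t-1}s(v_i,v_{i+1})D(v_i,v_{i+1})$. $D$ is a spanning representation if (1) for every path $p$, $D(p)=0$ iff $p$ is a cycle, and (2) for every spanning tree $T$, $\{D(t)\}_{t\in T}$ spans $\mathbb{R}^n$.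 The represented score of $w$ is $S_D(w)=\sum_{(u,v):\,s(u,v)=1}w(u,v)D(u,v)$, the sum being over edges in their positive direction. The Minkowski sum of vectors $v_1,\dots,v_k$ is $\{x: x=\sum_i\lambda_iv_i,\ \lambda_i\in[0,1]\}$. -}

module Defs where

open import Algebra.Bundles using (CommutativeRing)
open import Algebra.Structures using (IsCommutativeRing)
import Algebra.Properties.Ring as RingProperties
import Algebra.Properties.Semiring.Sum as SemiringSum
import Algebra.Properties.Semiring.Mult as SemiringMult
open import Data.Bool.Base using (if_then_else_; _∧_)
open import Data.Bool.Properties using (∧-comm)
open import Data.Fin.Base using (Fin; zero; suc)
open import Data.Fin.Properties using (_≟_)
open import Data.List.Base using (List; _∷_; [_]; allFin; cartesianProduct; filter; length; lookup)
open import Data.List.Membership.Propositional using (_∈_; _∉_)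
open import Data.List.Membership.Propositional.Properties using (∈-filter⁺; ∈-filter⁻; ∈-cartesianProduct⁺; ∈-allFin; ∈-lookup)
open import Data.List.Relation.Unary.Any using (here; there)
open import Data.List.Relation.Unary.Unique.Propositional using (Unique)
open import Data.List.Relation.Unary.Unique.Propositional.Properties using (filter⁺; cartesianProduct⁺; allFin⁺; Unique[x∷xs]⇒x∉xs)
open import Data.List.Relation.Unary.AllPairs using (_∷_)
open import Data.Nat.Base as ℕ using (ℕ; suc; zero)
import Data.Nat.Properties as ℕₚ
open import Data.Product.Base using (∃; _×_; _,_; proj₁; proj₂)
open import Data.Sign.Base as Sign using (Sign; opposite)
import Data.Sign.Properties as Signₚ
open import Data.Vec.Functional using (Vector)
import Data.Vec.Functional.Relation.Binary.Equality.Setoid as VectorEquality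
open import Function.Base using (_∘_)
open import Function.Bundles using (Func; _⇔_; Equivalence)
open import Level using (Level; _⊔_; 0ℓ) renaming (suc to lsuc)
open import Relation.Binary.Bundles using (Setoid)
open import Relation.Binary.Construct.Closure.ReflexiveTransitive using (Star; ε; _◅_; _◅◅_; reverse; revApp)
open import Relation.Binary.Core using (Rel; _⇒_)
open import Relation.Binary.Definitions using (Decidable; Irreflexive; Symmetric)
open import Relation.Binary.PropositionalEquality as ≡ using (_≡_)
import Relation.Binary.Reasoning.Setoid as SetoidReasoning
open import Relation.Binary.Structures using (IsDecTotalOrder)
open import Relation.Nullary.Decidable using (Dec; does; yes; no; _×-dec_)
open import Relation.Nullary.Negation using (¬_; contradiction)
open import Relation.Unary using (Pred)

-- ℝ enters through its classical characterisation as the Dedekind-complete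
-- ordered field.  As in classical mathematics the order is decidable.

record RealField (c ℓ₁ ℓ₂ : Level) : Set (lsuc (c ⊔ ℓ₁ ⊔ ℓ₂)) where
  infix  8 -_
  infixl 7 _*_
  infixl 6 _+_
  infix  4 _≈_ _≤_
  field
    Carrier : Set c
    _≈_     : Rel Carrier ℓ₁
    _≤_     : Rel Carrier ℓ₂
    _+_ _*_ : Carrier → Carrier → Carrier
    -_      : Carrier → Carrier
    0# 1#   : Carrier
    isCommutativeRing : IsCommutativeRing _≈_ _+_ _*_ -_ 0# 1#
    isDecTotalOrder   : IsDecTotalOrder _≈_ _≤_
    0≉1               : ¬ (0# ≈ 1#)
    inverse           : ∀ x → ¬ (x ≈ 0#) → ∃ λ y → x * y ≈ 1#
    +-monoʳ-≤         : ∀ x {y z} → y ≤ z → x + y ≤ x + z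
    *-nonNegative     : ∀ {x y} → 0# ≤ x → 0# ≤ y → 0# ≤ x * y

  UpperBound : ∀ {p} → Pred Carrier p → Pred Carrier (c ⊔ ℓ₂ ⊔ p)
  UpperBound P b = ∀ x → P x → x ≤ b

  field
    complete : (P : Pred Carrier (c ⊔ ℓ₁ ⊔ ℓ₂)) → ∃ P → ∃ (UpperBound P) →
               ∃ λ b → UpperBound P b × (∀ b′ → UpperBound P b′ → b ≤ b′)

  commutativeRing : CommutativeRing c ℓ₁
  commutativeRing = record { isCommutativeRing = isCommutativeRing }

  open CommutativeRing commutativeRing public
    hiding (Carrier; _≈_; _+_; _*_; -_; 0#; 1#; isCommutativeRing)

  open IsDecTotalOrder isDecTotalOrder public
    using (total; ≤-respʳ-≈; ≤-respˡ-≈; _≤?_)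
    renaming ( refl to ≤-refl; reflexive to ≤-reflexive; trans to ≤-trans
             ; antisym to ≤-antisym; _≟_ to _≈?_)

record SimpleGraph (m : ℕ) : Set₁ where
  field
    Adj        : Rel (Fin m) 0ℓ
    adj?       : Decidable Adj
    adj-sym    : Symmetric Adj
    adj-irrefl : Irreflexive _≡_ Adj

open SimpleGraph public

module _ {m : ℕ} where

  Path : SimpleGraph m → Rel (Fin m) 0ℓ
  Path G = Star (Adj G)

  module _ (G : SimpleGraph m) where

    vertices : ∀ {u v} → Path G u v → List (Fin m)
    vertices {u} ε       = [ u ]
    vertices {u} (_ ◅ p) = u ∷ vertices p

    Connected : Set
    Connected = ∀ u v → Path G u v

    -- A simple cycle is a path with at least three vertices, all distinct,
    -- whose last vertex is adjacent to its first.  (It is unrelated to the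
    -- closed walks along which payments are routed, which may repeat
    -- vertices and backtrack.)
    Acyclic : Set
    Acyclic = ∀ {u v} (p : Path G u v) → Unique (vertices p) →
              3 ℕ.≤ length (vertices p) → ¬ Adj G v u

  record IsSpanningTree (T G : SimpleGraph m) : Set where
    field
      subgraph  : Adj T ⇒ Adj G
      connected : Connected T
      acyclic   : Acyclic T

  traversals : (G : SimpleGraph m) → ∀ {u v} → Path G u v → Fin m → Fin m → ℕ
  traversals G ε a b = 0
  traversals G (_◅_ {u} {v} _ p) a b =
    (if does (u ≟ a) ∧ does (v ≟ b) then 1 else 0) ℕ.+ traversals G p a b

  record Orientation (G : SimpleGraph m) : Set where
    field
      sign     : Fin m → Fin m → Sign
      sign-opp : ∀ {u v} → Adj G u v → sign u v ≡ opposite (sign v u)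

  Positive : SimpleGraph m → (Fin m → Fin m → Sign) → Pred (Fin m × Fin m) 0ℓ
  Positive G s (u , v) = Adj G u v × s u v ≡ Sign.+

  positive? : ∀ G s e → Dec (Positive G s e)
  positive? G s (u , v) = adj? G u v ×-dec (s u v Signₚ.≟ Sign.+)

  -- When s is antisymmetric on the edges, this lists every undirected edge
  -- exactly once, in its positive direction.
  positiveEdges : SimpleGraph m → (Fin m → Fin m → Sign) → List (Fin m × Fin m)
  positiveEdges G s = filter (positive? G s) (cartesianProduct (allFin m) (allFin m))

  #edges : SimpleGraph m → (Fin m → Fin m → Sign) → ℕ
  #edges G s = length (positiveEdges G s)

  edge : ∀ G s → Vector (Fin m × Fin m) (#edges G s)
  edge G s = lookup (positiveEdges G s)

Image : ∀ {a b ℓ₁ ℓ₂} {A : Setoid a ℓ₁} {B : Setoid b ℓ₂} →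
        Func A B → Pred (Setoid.Carrier B) (a ⊔ ℓ₂)
Image {B = B} f y = ∃ λ x → Setoid._≈_ B (Func.to f x) y

module _ {c ℓ₁ ℓ₂ : Level} (ℝ : RealField c ℓ₁ ℓ₂) where

  open RealField ℝ hiding (zero)
  open SemiringSum semiring using (sum; ∑-distrib-+; sum-cong-≋; sum-replicate-zero; *-distribˡ-sum)
  open SemiringMult semiring using (×-homo-+) renaming (_×_ to _·_)
  open RingProperties ring using (-‿distribʳ-*; -‿distribˡ-*; -‿involutive; -‿+-comm; -0#≈0#)
  open VectorEquality setoid using (_≋_; ≋-setoid)

  Vec : ℕ → Set c
  Vec = Vector Carrier

  linearCombination : ∀ {n k} → Vector Carrier k → Vector (Vec n) k → Vec n
  linearCombination a v j = sum (λ i → a i * v i j)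

  Spans : ∀ {n k} → Vector (Vec n) k → Set (c ⊔ ℓ₁)
  Spans v = ∀ x → ∃ λ a → linearCombination a v ≋ x

  MinkowskiSum : ∀ {n k} → Vector (Vec n) k → Pred (Vec n) (c ⊔ ℓ₁ ⊔ ℓ₂)
  MinkowskiSum v x = ∃ λ a → (∀ i → 0# ≤ a i × a i ≤ 1#) × x ≋ linearCombination a v

  signed : Sign → Carrier → Carrier
  signed Sign.+ x = x
  signed Sign.- x = - x

  -- Maps defined on the edges (capacities, and D below) are total functions
  -- of two vertices; their values at non-adjacent pairs are never used.

  record PaymentNetwork (n : ℕ) : Set (lsuc 0ℓ ⊔ c ⊔ ℓ₁ ⊔ ℓ₂) where
    field
      graph        : SimpleGraph (suc n)
      connected    : Connected graph
      capacity     : Fin (suc n) → Fin (suc n) → Carrier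
      capacity-sym : ∀ {u v} → Adj graph u v → capacity u v ≈ capacity v u
      capacity-≥0  : ∀ {u v} → Adj graph u v → 0# ≤ capacity u v

  module _ {n : ℕ} (N : PaymentNetwork n) where

    open PaymentNetwork N

    record Configuration : Set (c ⊔ ℓ₁ ⊔ ℓ₂) where
      field
        weight   : Fin (suc n) → Fin (suc n) → Carrier
        weight≥0 : ∀ u v → 0# ≤ weight u v
        balanced : ∀ {u v} → Adj graph u v → weight u v + weight v u ≈ capacity u v
        off-edge : ∀ {u v} → ¬ Adj graph u v → weight u v ≈ 0#

    open Configuration

    flow : Carrier → ∀ {u v} → Path graph u v → Fin (suc n) → Fin (suc n) → Carrier
    flow k p a b = traversals graph p a b · k

    record Routes (w : Configuration) (k : Carrier) {u v : Fin (suc n)}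
                  (p : Path graph u v) (w′ : Configuration) : Set (ℓ₁ ⊔ ℓ₂) where
      field
        feasible : ∀ a b → flow k p a b ≤ weight w a b
        result   : ∀ a b → weight w′ a b ≈ weight w a b - flow k p a b + flow k p b a

    record RoutesCycle (w w′ : Configuration) : Set (c ⊔ ℓ₁ ⊔ ℓ₂) where
      field
        size   : Carrier
        size≥0 : 0# ≤ size
        base   : Fin (suc n)
        cycle  : Path graph base base
        routes : Routes w size cycle w′

    CycleEquivalent : Rel Configuration (c ⊔ ℓ₁ ⊔ ℓ₂)
    CycleEquivalent = Star RoutesCycle

    private

      traversals-revApp : ∀ {u v x} (p : Path graph u v) (q : Path graph u x) a b →
        traversals graph (revApp (adj-sym graph) p q) a b
          ≡ traversals graph p b a ℕ.+ traversals graph q a b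
      traversals-revApp ε q a b = ≡.refl
      traversals-revApp (_◅_ {u} {v} e p) q a b
        rewrite traversals-revApp p (adj-sym graph e ◅ q) a b
              | ∧-comm (does (v ≟ a)) (does (u ≟ b)) =
        ≡.trans (≡.sym (ℕₚ.+-assoc (traversals graph p b a) _ _))
                (≡.cong (ℕ._+ traversals graph q a b)
                        (ℕₚ.+-comm (traversals graph p b a) _))

      flow-reverse : ∀ k {u v} (p : Path graph u v) a b →
                     flow k (reverse (adj-sym graph) p) a b ≡ flow k p b a
      flow-reverse k p a b =
        ≡.cong (_· k) (≡.trans (traversals-revApp p ε a b) (ℕₚ.+-identityʳ _))

      x-y+y≈x : ∀ x y → x - y + y ≈ x
      x-y+y≈x x y = trans (+-assoc _ _ _) (trans (+-congˡ (-‿inverseˡ y)) (+-identityʳ x))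

      routesCycle-sym : Symmetric RoutesCycle
      routesCycle-sym {w} {w′} r = record
        { size   = size
        ; size≥0 = size≥0
        ; base   = base
        ; cycle  = reverse (adj-sym graph) cycle
        ; routes = record { feasible = feasible′ ; result = result′ }
        }
        where
        open RoutesCycle r
        open Routes routes
        f = flow size cycle

        feasible′ : ∀ a b → flow size (reverse (adj-sym graph) cycle) a b ≤ weight w′ a b
        feasible′ a b rewrite flow-reverse size cycle a b =
          ≤-respʳ-≈ (trans (+-comm _ _) (sym (result a b)))
            (≤-respˡ-≈ (+-identityʳ _) (+-monoʳ-≤ (f b a)
              (≤-respˡ-≈ (-‿inverseˡ _)
                (≤-respʳ-≈ (+-comm _ _) (+-monoʳ-≤ (- f a b) (feasible a b))))))

        result′ : ∀ a b → weight w a b ≈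
          weight w′ a b - flow size (reverse (adj-sym graph) cycle) a b
                        + flow size (reverse (adj-sym graph) cycle) b a
        result′ a b rewrite flow-reverse size cycle a b | flow-reverse size cycle b a =
          sym (begin
            weight w′ a b - f b a + f a b                    ≈⟨ +-congʳ (+-congʳ (result a b)) ⟩
            weight w a b - f a b + f b a - f b a + f a b     ≈⟨ +-congʳ (+-assoc _ _ _) ⟩
            weight w a b - f a b + (f b a - f b a) + f a b   ≈⟨ +-congʳ (+-congˡ (-‿inverseʳ _)) ⟩
            weight w a b - f a b + 0# + f a b                ≈⟨ +-congʳ (+-identityʳ _) ⟩
            weight w a b - f a b + f a b                     ≈⟨ x-y+y≈x _ _ ⟩
            weight w a b                                     ∎)
          where open SetoidReasoning setoid

    ConfigurationClasses : Setoid (c ⊔ ℓ₁ ⊔ ℓ₂) (c ⊔ ℓ₁ ⊔ ℓ₂)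
    ConfigurationClasses = record
      { Carrier       = Configuration
      ; _≈_           = CycleEquivalent
      ; isEquivalence = record
        { refl  = ε
        ; sym   = reverse routesCycle-sym
        ; trans = _◅◅_
        }
      }

  module _ {n : ℕ} (G : SimpleGraph (suc n)) (s : Orientation G)
           (D : Fin (suc n) → Fin (suc n) → Vec n) where

    open Orientation s

    direction : ∀ {u v} → Path G u v → Vec n
    direction ε                 j = 0#
    direction (_◅_ {u} {v} _ p) j = signed (sign u v) (D u v j) + direction p j

    record IsSpanningRepresentation : Set (lsuc 0ℓ ⊔ c ⊔ ℓ₁) where
      field
        -- D is a function of the undirected edge
        D-sym : ∀ {u v} → Adj G u v → D u v ≋ D v u
        direction≈0⇔cycle : ∀ {u v} (p : Path G u v) → (direction p ≋ λ _ → 0#) ⇔ u ≡ v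
        tree-spans : ∀ T → IsSpanningTree T G →
          Spans (λ i → let (u , v) = edge T sign i in D u v)

  module _ {n : ℕ} (N : PaymentNetwork n)
           (s : Orientation (PaymentNetwork.graph N))
           (D : Fin (suc n) → Fin (suc n) → Vec n) where

    open PaymentNetwork N
    open Orientation s
    open Configuration

    score : Configuration N → Vec n
    score w = linearCombination (λ i → let (u , v) = edge graph sign i in weight w u v)
                                (λ i → let (u , v) = edge graph sign i in D u v)

    module _ (isSR : IsSpanningRepresentation graph s D) where

      open IsSpanningRepresentation isSR

      private

        V = Fin (suc n)
        E = positiveEdges graph sign

        E-unique : Unique E
        E-unique = filter⁺ (positive? graph sign) (cartesianProduct⁺ (allFin⁺ _) (allFin⁺ _))

        ∈E⁺ : ∀ {u v} → Adj graph u v → sign u v ≡ Sign.+ → (u , v) ∈ E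
        ∈E⁺ {u} {v} e s+ =
          ∈-filter⁺ (positive? graph sign) (∈-cartesianProduct⁺ (∈-allFin u) (∈-allFin v)) (e , s+)

        ∉E : ∀ {u v} → sign u v ≡ Sign.- → (u , v) ∉ E
        ∉E s- ∈E with proj₂ (proj₂ (∈-filter⁻ (positive? graph sign)
                               {xs = cartesianProduct (allFin _) (allFin _)} ∈E))
        ... | s+ with ≡.trans (≡.sym s-) s+
        ... | ()

        δ : V × V → V × V → Carrier → Carrier
        δ (a , b) (u , v) k = (if does (a ≟ u) ∧ does (b ≟ v) then 1 else 0) · k

        δ-eq : ∀ x k → δ x x k ≈ k
        δ-eq (a , b) k with a ≟ a | b ≟ b
        ... | yes _ | yes _ = +-identityʳ k
        ... | yes _ | no b≢b = contradiction ≡.refl b≢b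
        ... | no a≢a | _ = contradiction ≡.refl a≢a

        δ-neq : ∀ x y k → ¬ x ≡ y → δ x y k ≈ 0#
        δ-neq (a , b) (u , v) k x≢y with a ≟ u | b ≟ v
        ... | yes ≡.refl | yes ≡.refl = contradiction ≡.refl x≢y
        ... | yes _ | no _ = refl
        ... | no _  | _    = refl

        δ-sum-∉ : ∀ x k (g : V × V → Carrier) es → x ∉ es →
                  sum (λ i → δ x (lookup es i) k * g (lookup es i)) ≈ 0#
        δ-sum-∉ x k g es x∉ = trans
          (sum-cong-≋ (λ i → trans (*-congʳ (δ-neq x (lookup es i) k
            λ { ≡.refl → x∉ (∈-lookup i) })) (zeroˡ _)))
          (sum-replicate-zero (length es))

        δ-sum-∈ : ∀ x k (g : V × V → Carrier) es → Unique es → x ∈ es →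
                  sum (λ i → δ x (lookup es i) k * g (lookup es i)) ≈ k * g x
        δ-sum-∈ x k g (_ ∷ es) u (here ≡.refl) =
          trans (+-cong (*-congʳ (δ-eq x k)) (δ-sum-∉ x k g es (Unique[x∷xs]⇒x∉xs u)))
                (+-identityʳ _)
        δ-sum-∈ x k g (y ∷ es) u@(_ ∷ u′) (there x∈) =
          trans (+-cong (trans (*-congʳ (δ-neq x y k
                           λ { ≡.refl → Unique[x∷xs]⇒x∉xs u x∈ })) (zeroˡ _))
                        (δ-sum-∈ x k g es u′ x∈))
                (+-identityˡ _)

        along : (V → V → Carrier) → V → V → Carrier
        along f u v = f u v - f v u

        total-along : (V → V → Carrier) → Vec n
        total-along f j =
          sum (λ i → let (u , v) = edge graph sign i in along f u v * D u v j)

        sum-neg : ∀ {k} (f : Vector Carrier k) → sum (λ i → - f i) ≈ - sum f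
        sum-neg {zero}  f = sym -0#≈0#
        sum-neg {suc k} f = trans (+-congˡ (sum-neg (f ∘ suc))) (-‿+-comm _ _)

        sum-sub : ∀ {k} (f g h : Vector Carrier k) →
                  sum (λ i → (f i - g i) * h i) ≈ sum (λ i → f i * h i) - sum (λ i → g i * h i)
        sum-sub {k} f g h = begin
          sum (λ i → (f i - g i) * h i)
            ≈⟨ sum-cong-≋ {n = k} (λ i → trans (distribʳ _ _ _) (+-congˡ (sym (-‿distribˡ-* _ _)))) ⟩
          sum (λ i → f i * h i + - (g i * h i))
            ≈⟨ ∑-distrib-+ (λ i → f i * h i) (λ i → - (g i * h i)) ⟩
          sum (λ i → f i * h i) + sum (λ i → - (g i * h i))
            ≈⟨ +-congˡ (sum-neg (λ i → g i * h i)) ⟩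
          sum (λ i → f i * h i) - sum (λ i → g i * h i) ∎
          where open SetoidReasoning setoid

        step : V → V → Carrier → V → V → Carrier
        step a b k u v = δ (a , b) (u , v) k

        step-swap : ∀ a b k u v → step a b k u v ≡ step b a k v u
        step-swap a b k u v =
          ≡.cong (λ t → (if t then 1 else 0) · k) (∧-comm (does (a ≟ u)) (does (b ≟ v)))

        total-along-step : ∀ {a b} → Adj graph a b → ∀ k j →
          total-along (step a b k) j ≈ k * signed (sign a b) (D a b j)
        total-along-step {a} {b} e k j = trans split (by-sign (sign a b) ≡.refl)
          where
          g : V × V → Carrier
          g (u , v) = D u v j

          P : V → V → Carrier
          P x y = sum (λ i → δ (x , y) (lookup E i) k * g (lookup E i))

          split : total-along (step a b k) j ≈ P a b - P b a
          split = trans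
            (sum-cong-≋ (λ i → let (u , v) = lookup E i in
              *-congʳ (+-congˡ (-‿cong (reflexive (step-swap a b k v u))))))
            (sum-sub (λ i → δ (a , b) (lookup E i) k) (λ i → δ (b , a) (lookup E i) k)
                     (λ i → g (lookup E i)))

          by-sign : ∀ t → sign a b ≡ t → P a b - P b a ≈ k * signed t (D a b j)
          by-sign Sign.+ s+ = trans
            (+-cong (δ-sum-∈ _ k g E E-unique (∈E⁺ e s+))
                    (trans (-‿cong (δ-sum-∉ _ k g E
                      (∉E (≡.trans (sign-opp (adj-sym graph e)) (≡.cong opposite s+)))))
                      -0#≈0#))
            (+-identityʳ _)
          by-sign Sign.- s- = trans
            (+-cong (δ-sum-∉ _ k g E (∉E s-))
                    (-‿cong (trans
                      (δ-sum-∈ _ k g E E-unique (∈E⁺ (adj-sym graph e)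
                        (≡.trans (sign-opp (adj-sym graph e)) (≡.cong opposite s-))))
                      (*-congˡ (D-sym (adj-sym graph e) j)))))
            (trans (+-identityˡ _) (-‿distribʳ-* _ _))

        [a+b]-[c+d] : ∀ a b c d → (a + b) - (c + d) ≈ (a - c) + (b - d)
        [a+b]-[c+d] a b c d = begin
          a + b - (c + d)        ≈⟨ +-congˡ (-‿+-comm c d) ⟨
          a + b + (- c - d)      ≈⟨ +-assoc _ _ _ ⟩
          a + (b + (- c - d))    ≈⟨ +-congˡ (+-assoc _ _ _) ⟨
          a + (b - c - d)        ≈⟨ +-congˡ (+-congʳ (+-comm _ _)) ⟩
          a + (- c + b - d)      ≈⟨ +-congˡ (+-assoc _ _ _) ⟩
          a + (- c + (b - d))    ≈⟨ +-assoc _ _ _ ⟨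
          a - c + (b - d)        ∎
          where open SetoidReasoning setoid

        total-along-flow : ∀ k {u v} (p : Path graph u v) j →
          total-along (flow N k p) j ≈ k * direction graph s D p j
        total-along-flow k ε j = trans
          (trans (sum-cong-≋ {n = length E} (λ i → trans (*-congʳ (-‿inverseʳ 0#)) (zeroˡ _)))
                 (sum-replicate-zero (length E)))
          (sym (zeroʳ k))
        total-along-flow k (_◅_ {a} {b} e p) j = begin
          total-along (flow N k (e ◅ p)) j
            ≈⟨ sum-cong-≋ (λ i → let (u , v) = lookup E i in
                 trans (*-congʳ (trans (+-cong (flow-◅ u v) (-‿cong (flow-◅ v u)))
                                       ([a+b]-[c+d] _ _ _ _)))
                       (distribʳ _ _ _)) ⟩
          sum (λ i → let (u , v) = lookup E i in
            along (step a b k) u v * D u v j + along (flow N k p) u v * D u v j)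
            ≈⟨ ∑-distrib-+
                 (λ i → let (u , v) = lookup E i in along (step a b k) u v * D u v j)
                 (λ i → let (u , v) = lookup E i in along (flow N k p) u v * D u v j) ⟩
          total-along (step a b k) j + total-along (flow N k p) j
            ≈⟨ +-cong (total-along-step e k j) (total-along-flow k p j) ⟩
          k * signed (sign a b) (D a b j) + k * direction graph s D p j
            ≈⟨ distribˡ _ _ _ ⟨
          k * direction graph s D (e ◅ p) j ∎
          where
          open SetoidReasoning setoid
          flow-◅ : ∀ u v → flow N k (e ◅ p) u v ≈ step a b k u v + flow N k p u v
          flow-◅ u v = ×-homo-+ k (if does (a ≟ u) ∧ does (b ≟ v) then 1 else 0)
                                (traversals graph p u v)

        score-routesCycle : ∀ {w w′} → RoutesCycle N w w′ → score w ≋ score w′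
        score-routesCycle {w} {w′} r j = sym (begin
          score w′ j
            ≈⟨ sum-cong-≋ (λ i → let (u , v) = lookup E i in
                 *-congʳ (trans (result u v) (regroup _ _ _))) ⟩
          sum (λ i → let (u , v) = lookup E i in (weight w u v - along f u v) * D u v j)
            ≈⟨ sum-sub (λ i → let (u , v) = lookup E i in weight w u v)
                       (λ i → let (u , v) = lookup E i in along f u v)
                       (λ i → let (u , v) = lookup E i in D u v j) ⟩
          score w j - total-along f j
            ≈⟨ +-congˡ (-‿cong (trans (total-along-flow size cycle j)
                 (trans (*-congˡ (Equivalence.from (direction≈0⇔cycle cycle) ≡.refl j))
                        (zeroʳ _)))) ⟩
          score w j - 0#
            ≈⟨ trans (+-congˡ -0#≈0#) (+-identityʳ _) ⟩
          score w j ∎)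
          where
          open SetoidReasoning setoid
          open RoutesCycle r
          open Routes routes
          f = flow N size cycle
          regroup : ∀ x y z → x - y + z ≈ x - (y - z)
          regroup x y z = trans (+-assoc _ _ _)
            (+-congˡ (trans (+-congˡ (sym (-‿involutive z))) (-‿+-comm y (- z))))

        score-cong : ∀ {w w′} → CycleEquivalent N w w′ → score w ≋ score w′
        score-cong ε        j = refl
        score-cong (r ◅ rs) j = trans (score-routesCycle r j) (score-cong rs j)

      representedScore : Func (ConfigurationClasses N) (≋-setoid n)
      representedScore = record { to = score ; cong = score-cong }

    scaledEdgeVectors : Vector (Vec n) (#edges graph sign)
    scaledEdgeVectors i j = let (x , y) = edge graph sign i in capacity x y * D x y j

module Submission where

open import Defs
import Algebra.Properties.Ring as RingProperties
import Algebra.Properties.Semiring.Sum as SemiringSum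
open import Data.Fin.Base using (Fin; zero; suc)
open import Data.Fin.Properties using (_≟_)
open import Data.List.Base using (List; []; _∷_; allFin; cartesianProduct; length; lookup)
open import Data.List.Membership.Propositional.Properties using (∈-filter⁻; ∈-lookup)
open import Data.List.Relation.Unary.AllPairs using (_∷_)
open import Data.List.Relation.Unary.Unique.Propositional using (Unique)
open import Data.List.Relation.Unary.Unique.Propositional.Properties using (filter⁺; cartesianProduct⁺; allFin⁺; Unique[x∷xs]⇒x∉xs)
open import Data.Nat.Base using (ℕ; suc)
open import Data.Product.Base using (∃; _×_; _,_; proj₁; proj₂)
open import Data.Product.Properties using (≡-dec)
open import Data.Sign.Base as Sign using (Sign; opposite)
open import Data.Sum.Base using (inj₁; inj₂)
open import Data.Vec.Functional using (Vector; tail)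
open import Level using (Level)
open import Relation.Binary.Definitions using (DecidableEquality)
open import Relation.Binary.PropositionalEquality as ≡ using (_≡_)
import Relation.Binary.Reasoning.Setoid as SetoidReasoning
open import Relation.Nullary.Decidable using (Dec; yes; no)
open import Relation.Nullary.Negation using (¬_; contradiction)
open import Relation.Unary using (_≐_)

-- A weight with 0 ≤ w(u,v) ≤ c(u,v) is the same as a fraction λ ∈ [0,1] with
-- w(u,v) = λ c(u,v); the fraction is w(u,v) / c(u,v), or 0 on an edge of
-- capacity zero.  A configuration is determined by its weights on positively
-- oriented edges, and these can be chosen independently, the reverse direction
-- receiving the complementary fraction 1 − λ.

-- Extending a family indexed by list positions to the whole type

module _ {a b} {A : Set a} {B : Set b} (_≟ᴬ_ : DecidableEquality A) (default : B) where

  extend : (xs : List A) → Vector B (length xs) → A → B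
  extend []       f x = default
  extend (y ∷ ys) f x with x ≟ᴬ y
  ... | yes _ = f zero
  ... | no  _ = extend ys (tail f) x

  -- The search stops at the first match. In a list without repetitions this is position `i` itself
  -- and not an earlier copy.
  extend-lookup : ∀ {xs} → Unique xs → (f : Vector B (length xs)) →
                  ∀ i → extend xs f (lookup xs i) ≡ f i
  extend-lookup {y ∷ ys} u f zero with y ≟ᴬ y
  ... | yes _   = ≡.refl
  ... | no  y≢y = contradiction ≡.refl y≢y
  extend-lookup {y ∷ ys} u@(_ ∷ u′) f (suc i) with lookup ys i ≟ᴬ y
  -- A match with the head would put `y` into its own tail.
  ... | yes ≡.refl = contradiction (∈-lookup i) (Unique[x∷xs]⇒x∉xs u)
  ... | no  _      = extend-lookup u′ (tail f) i

module _ {m : ℕ} (G : SimpleGraph m) (s : Fin m → Fin m → Sign) where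

  positiveEdges-unique : Unique (positiveEdges G s)
  positiveEdges-unique =
    filter⁺ (positive? G s) (cartesianProduct⁺ (allFin⁺ m) (allFin⁺ m))

  edge-positive : ∀ i → Positive G s (edge G s i)
  edge-positive i = proj₂ (∈-filter⁻ (positive? G s)
    {xs = cartesianProduct (allFin m) (allFin m)} (∈-lookup i))

-- Ordered field arithmetic and fractions

module _ {c ℓ₁ ℓ₂ : Level} (ℝ : RealField c ℓ₁ ℓ₂) where

  open RealField ℝ hiding (zero)
  open RingProperties ring
    using (-‿distribʳ-*; -‿distribˡ-*; -‿involutive)
  open SemiringSum semiring using (sum-cong-≋)
  open SetoidReasoning setoid

  x≤y⇒0≤y-x : ∀ {x y} → x ≤ y → 0# ≤ y - x
  x≤y⇒0≤y-x {x} {y} x≤y =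
    ≤-respˡ-≈ (-‿inverseˡ x) (≤-respʳ-≈ (+-comm (- x) y) (+-monoʳ-≤ (- x) x≤y))

  y-x+x≈y : ∀ x y → (y - x) + x ≈ y
  y-x+x≈y x y = trans (+-assoc _ _ _) (trans (+-congˡ (-‿inverseˡ x)) (+-identityʳ y))

  0≤y⇒x≤x+y : ∀ {x y} → 0# ≤ y → x ≤ x + y
  0≤y⇒x≤x+y {x} 0≤y = ≤-respˡ-≈ (+-identityʳ x) (+-monoʳ-≤ x 0≤y)

  0≤y-x⇒x≤y : ∀ {x y} → 0# ≤ y - x → x ≤ y
  0≤y-x⇒x≤y {x} {y} 0≤ =
    ≤-respʳ-≈ (trans (+-comm _ _) (y-x+x≈y x y)) (0≤y⇒x≤x+y 0≤)

  x≤0⇒0≤-x : ∀ {x} → x ≤ 0# → 0# ≤ - x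
  x≤0⇒0≤-x x≤0 = ≤-respʳ-≈ (+-identityˡ _) (x≤y⇒0≤y-x x≤0)

  0≤1 : 0# ≤ 1#
  0≤1 with total 0# 1#
  ... | inj₁ 0≤1′ = 0≤1′
  -- If 1 ≤ 0 then -1 is nonnegative, and so is its square, which is 1.
  ... | inj₂ 1≤0  = ≤-respʳ-≈ square (*-nonNegative 0≤-1 0≤-1)
    where
    0≤-1 : 0# ≤ - 1#
    0≤-1 = x≤0⇒0≤-x 1≤0

    square : - 1# * - 1# ≈ 1#
    square = begin
      - 1# * - 1#     ≈⟨ -‿distribˡ-* 1# (- 1#) ⟨
      - (1# * - 1#)   ≈⟨ -‿cong (*-identityˡ _) ⟩
      - - 1#          ≈⟨ -‿involutive 1# ⟩
      1#              ∎

  *-monoʳ-≤-nonNeg : ∀ {x y z} → 0# ≤ z → x ≤ y → x * z ≤ y * z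
  *-monoʳ-≤-nonNeg {x} {y} {z} 0≤z x≤y = 0≤y-x⇒x≤y
    (≤-respʳ-≈ (trans (distribʳ z y (- x)) (+-congˡ (sym (-‿distribˡ-* x z))))
      (*-nonNegative (x≤y⇒0≤y-x x≤y) 0≤z))

  -- If y were ≤ 0, then x (-y) = -1 would be a product of nonnegative numbers, forcing 1 ≤ 0 and
  -- hence 0 = 1.
  inverse-nonNeg : ∀ {x y} → 0# ≤ x → x * y ≈ 1# → 0# ≤ y
  inverse-nonNeg {x} {y} 0≤x xy≈1 with total 0# y
  ... | inj₁ 0≤y = 0≤y
  ... | inj₂ y≤0 = contradiction (≤-antisym 0≤1 1≤0) 0≉1
    where
    1≤0 : 1# ≤ 0#
    1≤0 = 0≤y-x⇒x≤y (≤-respʳ-≈ (begin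
      x * - y     ≈⟨ -‿distribʳ-* x y ⟨
      - (x * y)   ≈⟨ -‿cong xy≈1 ⟩
      - 1#        ≈⟨ +-identityˡ _ ⟨
      0# - 1#     ∎) (*-nonNegative 0≤x (x≤0⇒0≤-x y≤0)))

  -- The bounds travel with the number, so extending a family of fractions to all vertex pairs keeps
  -- them valid everywhere.
  UnitInterval : Set _
  UnitInterval = ∃ λ t → 0# ≤ t × t ≤ 1#

  fraction : ∀ {x y} → 0# ≤ x → x ≤ y → ∃ λ (t : UnitInterval) → x ≈ proj₁ t * y
  fraction {x} {y} 0≤x x≤y with y ≈? 0#
  -- Here `x` is squeezed to 0, so every fraction would do.
  ... | yes y≈0 = (0# , ≤-refl , 0≤1) ,
    trans (≤-antisym (≤-respʳ-≈ y≈0 x≤y) 0≤x) (sym (zeroˡ y))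
  -- The fraction is x/y; multiplying x ≤ y by the nonnegative inverse `z` gives x z ≤ y z = 1.
  ... | no y≉0 = let z , yz≈1 = inverse y y≉0
                     0≤z = inverse-nonNeg (≤-trans 0≤x x≤y) yz≈1
    in (x * z , *-nonNegative 0≤x 0≤z , ≤-respʳ-≈ yz≈1 (*-monoʳ-≤-nonNeg 0≤z x≤y)) , (begin
      x             ≈⟨ *-identityʳ x ⟨
      x * 1#        ≈⟨ *-congˡ (trans (*-comm z y) yz≈1) ⟨
      x * (z * y)   ≈⟨ *-assoc x z y ⟨
      x * z * y     ∎)

  -- Configurations and scores in terms of edge fractions

  module _ {n : ℕ} (N : PaymentNetwork ℝ n) where

    open PaymentNetwork N
    open Configuration

    weight≤capacity : (w : Configuration ℝ N) →
                      ∀ {u v} → Adj graph u v → weight w u v ≤ capacity u v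
    weight≤capacity w {u} {v} e =
      ≤-respʳ-≈ (balanced w e) (0≤y⇒x≤x+y (weight≥0 w v u))

    module _ (s : Orientation graph) (t : Fin (suc n) × Fin (suc n) → UnitInterval) where

      open Orientation s

      -- Whichever direction is asked for, `t` is read at the positively oriented pair when the sign
      -- is that of an edge. The sign is a separate argument so that proofs can split on it.
      share : Sign → Fin (suc n) → Fin (suc n) → Carrier
      share Sign.+ u v = proj₁ (t (u , v))
      share Sign.- u v = 1# - proj₁ (t (v , u))

      share≥0 : ∀ σ u v → 0# ≤ share σ u v
      share≥0 Sign.+ u v = proj₁ (proj₂ (t (u , v)))
      share≥0 Sign.- u v = x≤y⇒0≤y-x (proj₂ (proj₂ (t (v , u))))

      -- Both shares read `t` at the same ordered pair, one as t and the other as 1 - t.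
      share-opposite : ∀ σ u v → share (opposite σ) u v + share σ v u ≈ 1#
      share-opposite Sign.+ u v = y-x+x≈y _ _
      share-opposite Sign.- u v = trans (+-comm _ _) (y-x+x≈y _ _)

      share-sum : ∀ {u v} → Adj graph u v →
                  share (sign u v) u v + share (sign v u) v u ≈ 1#
      share-sum {u} {v} e rewrite sign-opp e = share-opposite (sign v u) u v

      -- Taking the adjacency decision as an argument lets the lemmas below match on it directly.
      shareWeight : ∀ {u v} → Dec (Adj graph u v) → Carrier
      shareWeight {u} {v} (yes _) = share (sign u v) u v * capacity u v
      shareWeight         (no _)  = 0#

      shareWeight-adj : ∀ {u v} (d : Dec (Adj graph u v)) → Adj graph u v →
                        shareWeight d ≡ share (sign u v) u v * capacity u v
      shareWeight-adj (yes _) e = ≡.refl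
      shareWeight-adj (no ¬e) e = contradiction e ¬e

      shareWeight≥0 : ∀ {u v} (d : Dec (Adj graph u v)) → 0# ≤ shareWeight d
      shareWeight≥0 {u} {v} (yes e) = *-nonNegative (share≥0 (sign u v) u v) (capacity-≥0 e)
      shareWeight≥0         (no _)  = ≤-refl

      shareConfiguration : Configuration ℝ N
      shareConfiguration = record
        { weight   = λ u v → shareWeight (adj? graph u v)
        ; weight≥0 = λ u v → shareWeight≥0 (adj? graph u v)
        ; balanced = balanced′
        ; off-edge = λ {u} {v} → off-edge′ (adj? graph u v)
        }
        where
        balanced′ : ∀ {u v} → Adj graph u v →
          shareWeight (adj? graph u v) + shareWeight (adj? graph v u) ≈ capacity u v
        balanced′ {u} {v} e = begin
          shareWeight (adj? graph u v) + shareWeight (adj? graph v u)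
            ≈⟨ +-cong (reflexive (shareWeight-adj (adj? graph u v) e))
                      (reflexive (shareWeight-adj (adj? graph v u) (adj-sym graph e))) ⟩
          share (sign u v) u v * capacity u v + share (sign v u) v u * capacity v u
            -- Symmetry of the capacity gives both directions the common factor that is then taken
            -- out.
            ≈⟨ +-congˡ (*-congˡ (capacity-sym e)) ⟨
          share (sign u v) u v * capacity u v + share (sign v u) v u * capacity u v
            ≈⟨ distribʳ _ _ _ ⟨
          (share (sign u v) u v + share (sign v u) v u) * capacity u v
            ≈⟨ *-congʳ (share-sum e) ⟩
          1# * capacity u v
            ≈⟨ *-identityˡ _ ⟩
          capacity u v ∎

        off-edge′ : ∀ {u v} (d : Dec (Adj graph u v)) → ¬ Adj graph u v → shareWeight d ≈ 0#
        off-edge′ (yes e) ¬e = contradiction e ¬e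
        off-edge′ (no _)  _  = refl

      shareConfiguration-positive : ∀ {u v} → Positive graph sign (u , v) →
        weight shareConfiguration u v ≡ proj₁ (t (u , v)) * capacity u v
      shareConfiguration-positive {u} {v} (e , s+) = ≡.trans
        (shareWeight-adj (adj? graph u v) e)
        (≡.cong (λ σ → share σ u v * capacity u v) s+)

    module _ (s : Orientation graph) (D : Fin (suc n) → Fin (suc n) → Vec ℝ n) where

      open Orientation s

      -- The bridge used for both inclusions: the score reads weights on positive edges only, so
      -- replacing each by a fraction of the capacity yields a combination of the scaled vectors.
      score-fraction : (w : Configuration ℝ N) (a : Vector Carrier (#edges graph sign)) →
        (∀ i → let (u , v) = edge graph sign i in weight w u v ≈ a i * capacity u v) →
        ∀ j → score ℝ N s D w j ≈ linearCombination ℝ a (scaledEdgeVectors ℝ N s D) j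
      score-fraction w a w≈ j =
        sum-cong-≋ (λ i → trans (*-congʳ (w≈ i)) (*-assoc _ _ _))

theorem3p7 : {c ℓ₁ ℓ₂ : Level} (ℝ : RealField c ℓ₁ ℓ₂) {n : ℕ}
    (N : PaymentNetwork ℝ n) (s : Orientation (PaymentNetwork.graph N))
    (D : Fin (suc n) → Fin (suc n) → Vec ℝ n)
    (isSR : IsSpanningRepresentation ℝ (PaymentNetwork.graph N) s D) →
    Image (representedScore ℝ N s D isSR) ≐ MinkowskiSum ℝ (scaledEdgeVectors ℝ N s D)
theorem3p7 ℝ N s D isSR = image⊆sum , sum⊆image
  where
  open RealField ℝ hiding (zero)
  open PaymentNetwork N
  open Orientation s
  open Configuration

  image⊆sum : ∀ {x} → Image (representedScore ℝ N s D isSR) x →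
              MinkowskiSum ℝ (scaledEdgeVectors ℝ N s D) x
  -- The coefficients are the fractions of capacity held by the representative `w` on the positive
  -- edges.
  image⊆sum (w , score≈x) =
    (λ i → proj₁ (proj₁ (t i))) , (λ i → proj₂ (proj₁ (t i))) ,
    λ j → trans (sym (score≈x j))
                (score-fraction ℝ N s D w _ (λ i → proj₂ (t i)) j)
    where
    t : ∀ i → let (u , v) = edge graph sign i in
        ∃ λ (t : UnitInterval ℝ) → weight w u v ≈ proj₁ t * capacity u v
    t i = fraction ℝ (weight≥0 w _ _)
                     (weight≤capacity ℝ N w (proj₁ (edge-positive graph sign i)))

  sum⊆image : ∀ {x} → MinkowskiSum ℝ (scaledEdgeVectors ℝ N s D) x →
              Image (representedScore ℝ N s D isSR) x
  sum⊆image (a , a∈[0,1] , x≈) = w , λ j →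
    trans (score-fraction ℝ N s D w a w≈ j) (sym (x≈ j))
    where
    a′ : Vector (UnitInterval ℝ) (#edges graph sign)
    a′ i = a i , a∈[0,1] i

    -- The value of `t` off the list of positive edges. It must lie in [0,1] because `share≥0`
    -- covers all pairs, but shares of adjacent pairs never read it.
    0ᴵ : UnitInterval ℝ
    0ᴵ = 0# , ≤-refl , 0≤1 ℝ

    t : _ → UnitInterval ℝ
    t = extend (≡-dec _≟_ _≟_) 0ᴵ (positiveEdges graph sign) a′

    w : Configuration ℝ N
    w = shareConfiguration ℝ N s t

    w≈ : ∀ i → let (u , v) = edge graph sign i in weight w u v ≈ a i * capacity u v
    -- A positive edge has weight t c, and `t` returns the prescribed `a i` there because the edge
    -- list has no repetitions.
    w≈ i = trans
      (reflexive (shareConfiguration-positive ℝ N s t (edge-positive graph sign i)))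
      (*-congʳ (reflexive (≡.cong proj₁
        (extend-lookup (≡-dec _≟_ _≟_) 0ᴵ (positiveEdges-unique graph sign) a′ i))))
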